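{- Let $q=p^h$, $p$ prime, $h\ge1$, $n\ge2$, $1\le k\le n-1$. If $p=7$, the minimum weight of $C_k(n,q)^\perp$ is at least $(12\theta_{n-k}+2)/7$; if $p>7$, it is at least $(12\theta_{n-k}+6)/7$.
   Context: $\theta_m=(q^{m+1}-1)/(q-1)$. $C_k(n,q)$ is the $p$-ary linear code spanned over $\mathbb{F}_p$ by the rows of the incidence matrix of $k$-dimensional subspaces versus points of $PG(n,q)$, and $C_k(n,q)^\perp$ its dual with respect to the standard scalar product; minimum weight is over nonzero codewords. -}

module Defs where

open import Data.Nat using (ℕ; zero; suc; _+_; _*_; _^_)
open import Data.Fin as Fin using (Fin)
open import Data.Bool using (Bool; true; false; if_then_else_; not)
open import Data.List as List using (List; []; _∷_; [_]; allFin; concatMap; filterᵇ; length)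
open import Data.Vec as Vec using (Vec; []; _∷_; replicate; zipWith)
import Data.Vec.Properties as VecP
open import Relation.Nullary.Decidable using (isYes)
open import Relation.Binary.PropositionalEquality using (_≡_; _≢_)
open import Algebra.Structures using (IsCommutativeRing)
open import Data.Nat.Divisibility using (_∣_)
open import Data.Nat using () renaming (_≟_ to _ℕ≟_)
open import Data.Bool.ListAction using (any)
open import Data.Nat.ListAction using (sum)

θ : ℕ → ℕ → ℕ
θ zero    q = 1
θ (suc m) q = q ^ suc m + θ m q

-- A finite field of order q, with carrier Fin q (every finite field of order
-- q is in bijection with Fin q).
record FiniteField (q : ℕ) : Set where
  infixl 6 _⊕_
  infixl 7 _⊗_
  field
    _⊕_ _⊗_ : Fin q → Fin q → Fin q
    ⊖_ _⁻¹  : Fin q → Fin q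
    0# 1#   : Fin q
    isCommutativeRing : IsCommutativeRing _≡_ _⊕_ _⊗_ ⊖_ 0# 1#
    0≢1     : 0# ≢ 1#
    ⁻¹-inverse : ∀ x → x ≢ 0# → x ⊗ (x ⁻¹) ≡ 1#

module PG {q : ℕ} (F : FiniteField q) (n : ℕ) where
  open FiniteField F

  allVecs : (m : ℕ) → List (Vec (Fin q) m)
  allVecs zero    = [ [] ]
  allVecs (suc m) = concatMap (λ x → List.map (x ∷_) (allVecs m)) (allFin q)

  normalized : ∀ {m} → Vec (Fin q) m → Bool
  normalized []      = false
  normalized (x ∷ v) = if isYes (x Fin.≟ 0#) then normalized v else isYes (x Fin.≟ 1#)

  -- points of PG(n,q): 1-dim subspaces of F^(n+1), one normalized
  -- representative each
  points : List (Vec (Fin q) (suc n))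
  points = filterᵇ normalized (allVecs (suc n))

  comb : ∀ {m} → Vec (Fin q) m → Vec (Vec (Fin q) (suc n)) m → Vec (Fin q) (suc n)
  comb []      []      = replicate (suc n) 0#
  comb (a ∷ l) (b ∷ B) = zipWith _⊕_ (Vec.map (a ⊗_) b) (comb l B)

  LinIndep : ∀ {m} → Vec (Vec (Fin q) (suc n)) m → Set
  LinIndep {m} B = ∀ (l : Vec (Fin q) m) → comb l B ≡ replicate (suc n) 0# → l ≡ replicate m 0#

  inSpan : ∀ {m} → Vec (Vec (Fin q) (suc n)) m → Vec (Fin q) (suc n) → Bool
  inSpan {m} B v = any (λ l → isYes (VecP.≡-dec Fin._≟_ (comb l B) v)) (allVecs m)

  -- the points of the k-dimensional projective subspace spanned by the
  -- (k+1) linearly independent vectors B (one row of the incidence matrix)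
  subspacePoints : ∀ {m} → Vec (Vec (Fin q) (suc n)) m → List (Vec (Fin q) (suc n))
  subspacePoints B = filterᵇ (inSpan B) points

  -- A word over F_p indexed by the points: c assigns to each (normalized)
  -- vector an element of F_p = Fin p; only its values on `points` matter.
  Word : ℕ → Set
  Word p = Vec (Fin q) (suc n) → Fin p

  -- c ∈ C_k(n,q)^⊥ : c is orthogonal (over F_p) to the incidence vector of
  -- every k-dimensional subspace, i.e. Σ_{P ∈ S} c(P) ≡ 0 (mod p).
  InDual : (p k : ℕ) → Word p → Set
  InDual p k c = ∀ (B : Vec (Vec (Fin q) (suc n)) (suc k)) → LinIndep B →
                 p ∣ sum (List.map (λ P → Fin.toℕ (c P)) (subspacePoints B))

  weight : ∀ {p} → Word p → ℕ
  weight c = length (filterᵇ (λ P → not (isYes (Fin.toℕ (c P) ℕ≟ 0))) points)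

{-# OPTIONS --safe #-}
module Submission where

-- The bound is that of Bagchi and Inamdar. Put r = θ (n ∸ k) q, and scale a dual
-- word so that it takes the value 1 at a point P. Unless the support is very large,
-- some (k−1)-space R meets the support in P only. The k-spaces through R are the r
-- points of the quotient by R, and they partition the points outside R; in each of
-- them the representatives in {0, …, p−1} of the values off P sum to at least p−1,
-- so all representatives sum to at least 1 + (p−1) r. If the value −1 occurs as well,
-- the negated word obeys the same bound; as x and −x have representatives with sum p,
-- p·w ≥ 2((p−1) r + 1). If −1 does not occur, each k-space through R contains at least
-- two further support points, so w ≥ 2r + 1. R is grown from P one dimension at a time;
-- this gets stuck only if every space one dimension up contains a further support
-- point, and then w > θ (n ∸ k + 1) q ≥ 2r.

open import Defs
open import Data.Nat using (ℕ; suc; _+_; _*_; _^_; _≤_; _<_; _∸_)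
open import Data.Nat
  using (zero; pred; NonZero; z≤n; s≤s; z<s; >-nonZero; >-nonZero⁻¹; nonTrivial⇒n>1; _≤?_; _≟_)
open import Data.Nat.Properties
  using (≤-refl; ≤-reflexive; ≤-trans; ≤-pred; n≤1+n; n≤0⇒n≡0; n<1⇒n≡0; ≰⇒>; ≤∧≢⇒<; m≤n⇒m<n∨m≡n; m≤n⇒∃[o]m+o≡n
        ; m≤m+n; m≤n+m; m≤m*n; +-mono-≤; +-monoʳ-≤; +-monoˡ-≤; +-mono-<; *-monoˡ-≤; *-monoʳ-≤
        ; *-cancelˡ-≤; *-cancelˡ-<; *-cancelʳ-<; +-suc; +-comm; +-assoc; +-identityʳ; m+n∸m≡n; suc-pred; m^n≢0
        ; *-suc; *-comm; *-assoc; *-identityˡ; *-identityʳ; *-zeroʳ; *-distribˡ-+; module ≤-Reasoning)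
open import Data.Nat.DivMod using (_/_; _%_; m≡m%n+[m/n]*n; m%n<n; m<n⇒m%n≡m; [m+kn]%n≡m%n)
open import Data.Nat.Divisibility using (_∣_; divides; ∣⇒≤; m∣m*n; ∣n⇒∣m*n; ∣m+n∣m⇒∣n)
open import Data.Nat.GCD using (module Bézout)
open import Data.Nat.Coprimality using (prime⇒coprime; coprime-Bézout)
open import Data.Nat.ListAction using (sum)
open import Data.Nat.Primality using (Prime; prime?; prime⇒nonZero; prime⇒nonTrivial)
open import Data.Nat.Tactic.RingSolver using (solve-∀)
open import Data.Bool using (Bool; true; false; if_then_else_; T; not)
open import Data.Fin as Fin using (Fin; toℕ)
open import Data.Fin.Properties using (toℕ<n)
open import Data.List as List using (List; []; _∷_; length; filterᵇ; allFin; concatMap; cartesianProductWith)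
open import Data.List.Properties using (length-++; length-map; length-tabulate)
open import Data.List.Membership.Propositional using (_∈_; find; lose)
open import Data.List.Membership.Propositional.Properties
  using (∈-cartesianProductWith⁺; ∈-allFin; ∈-map⁻; ∈-++⁻; ∈-filter⁻)
open import Data.List.Relation.Unary.Any as Any using (here; there)
open import Data.List.Relation.Unary.Any.Properties using (any⁺; any⁻)
open import Data.List.Relation.Unary.All as All using (All; []; _∷_)
open import Data.List.Relation.Unary.All.Properties using (¬All⇒Any¬)
open import Data.List.Relation.Unary.AllPairs using ([]; _∷_)
open import Data.List.Relation.Unary.Unique.Propositional using (Unique)
import Data.List.Relation.Unary.Unique.Propositional.Properties as Unique
open import Data.Product using (_×_; _,_; ∃; proj₁; proj₂)
open import Data.Sum using (_⊎_; inj₁; inj₂)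
open import Data.Vec as Vec using (Vec; []; _∷_; replicate; zipWith)
open import Data.Vec.Properties
  using (≡-dec; ∷-injective; ∷-injectiveˡ; ∷-injectiveʳ; zipWith-identityˡ; zipWith-identityʳ; zipWith-assoc)
open import Algebra.Bundles using (CommutativeRing)
import Algebra.Properties.Ring
import Algebra.Properties.CommutativeSemigroup
open import Function using (_∘_; id)
open import Relation.Nullary using (Dec; yes; no; ¬_; contradiction)
open import Relation.Nullary.Decidable using (isYes; from-no; T?)
open import Relation.Binary.Definitions using (DecidableEquality)
open import Relation.Binary.PropositionalEquality
  using (_≡_; _≢_; refl; sym; trans; cong; cong₂; subst; module ≡-Reasoning)

-- Finite sums over lists.

∑ : ∀ {A : Set} → List A → (A → ℕ) → ℕ
∑ xs f = sum (List.map f xs)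

module _ {A : Set} where

  ∑-mono : ∀ {xs : List A} {f g} → (∀ {x} → x ∈ xs → f x ≤ g x) → ∑ xs f ≤ ∑ xs g
  ∑-mono {[]}     f≤g = z≤n
  ∑-mono {x ∷ xs} f≤g = +-mono-≤ (f≤g (here refl)) (∑-mono (f≤g ∘ there))

  ∑-+ : ∀ (xs : List A) f g → ∑ xs (λ x → f x + g x) ≡ ∑ xs f + ∑ xs g
  ∑-+ []       f g = refl
  ∑-+ (x ∷ xs) f g rewrite ∑-+ xs f g = interchange (f x) (g x) (∑ xs f) (∑ xs g)
    where
    interchange : ∀ a b c d → a + b + (c + d) ≡ a + c + (b + d)
    interchange = solve-∀

  ∑-* : ∀ k (xs : List A) f → ∑ xs (λ x → k * f x) ≡ k * ∑ xs f
  ∑-* k []       f = sym (*-zeroʳ k)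
  ∑-* k (x ∷ xs) f rewrite ∑-* k xs f = sym (*-distribˡ-+ k (f x) (∑ xs f))

  ∑-const-≤ : ∀ {t} {xs : List A} {f} → (∀ {x} → x ∈ xs → t ≤ f x) → t * length xs ≤ ∑ xs f
  ∑-const-≤ {t} {[]}     t≤f = ≤-reflexive (*-zeroʳ t)
  ∑-const-≤ {t} {x ∷ xs} t≤f = ≤-trans (≤-reflexive (*-suc t (length xs)))
    (+-mono-≤ (t≤f (here refl)) (∑-const-≤ (t≤f ∘ there)))

  ∑-filter : ∀ (b : A → Bool) xs f → ∑ (filterᵇ b xs) f ≡ ∑ xs (λ x → if b x then f x else 0)
  ∑-filter b []       f = refl
  ∑-filter b (x ∷ xs) f with b x
  ... | true  = cong (f x +_) (∑-filter b xs f)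
  ... | false = ∑-filter b xs f

  -- Slack at the single entry `P` survives in the total. In `∑-classes` this entry is the centre,
  -- which no class counts.
  ∑-mono-gap : ∀ {xs : List A} {f g P a} → P ∈ xs → (∀ {x} → x ∈ xs → f x ≤ g x) →
               a + f P ≤ g P → a + ∑ xs f ≤ ∑ xs g
  ∑-mono-gap {x ∷ xs} {f} {a = a} (here refl) f≤g gap =
    ≤-trans (≤-reflexive (sym (+-assoc a (f x) (∑ xs f)))) (+-mono-≤ gap (∑-mono (f≤g ∘ there)))
  ∑-mono-gap {x ∷ xs} {f} {g} {a = a} (there P∈xs) f≤g gap = begin
    a + (f x + ∑ xs f)  ≡⟨ swap a (f x) (∑ xs f) ⟩
    f x + (a + ∑ xs f)  ≤⟨ +-mono-≤ (f≤g (here refl)) (∑-mono-gap P∈xs (f≤g ∘ there) gap) ⟩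
    g x + ∑ xs g        ∎
    where
    open ≤-Reasoning
    swap : ∀ a b c → a + (b + c) ≡ b + (a + c)
    swap = solve-∀

  term≤∑ : ∀ {xs : List A} {f P} → P ∈ xs → f P ≤ ∑ xs f
  term≤∑ {x ∷ xs} {f} (here refl) = m≤m+n (f x) _
  term≤∑ {x ∷ xs} {f} (there P∈xs) = ≤-trans (term≤∑ P∈xs) (m≤n+m _ (f x))

  -- Each `u * f x` differs from its remainder by a multiple of `p`, so `u * ∑ xs f` and the sum of
  -- the remainders are congruent. Hence a dual word stays dual when it is scaled and reduced to
  -- representatives.
  ∣∑-scale : ∀ p .{{_ : NonZero p}} u (xs : List A) f → p ∣ ∑ xs f → p ∣ ∑ xs (λ x → (u * f x) % p)
  ∣∑-scale p u xs f p∣∑ = ∣m+n∣m⇒∣n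
    (subst (p ∣_) split (∣n⇒∣m*n u p∣∑))
    (m∣m*n (∑ xs (λ x → (u * f x) / p)))
    where
    split : u * ∑ xs f ≡ p * ∑ xs (λ x → (u * f x) / p) + ∑ xs (λ x → (u * f x) % p)
    split = begin
      u * ∑ xs f                     ≡⟨ ∑-* u xs f ⟨
      ∑ xs (λ x → u * f x)           ≡⟨ ∑-cong xs ⟩
      ∑ xs (λ x → p * ((u * f x) / p) + (u * f x) % p)
                                     ≡⟨ ∑-+ xs _ _ ⟩
      ∑ xs (λ x → p * ((u * f x) / p)) + ∑ xs (λ x → (u * f x) % p)
                                     ≡⟨ cong (_+ ∑ xs (λ x → (u * f x) % p)) (∑-* p xs _) ⟩
      p * ∑ xs (λ x → (u * f x) / p) + ∑ xs (λ x → (u * f x) % p) ∎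
      where
      open ≡-Reasoning
      ∑-cong : ∀ ys → ∑ ys (λ x → u * f x) ≡ ∑ ys (λ x → p * ((u * f x) / p) + (u * f x) % p)
      ∑-cong []       = refl
      ∑-cong (y ∷ ys) = cong₂ _+_
        (trans (m≡m%n+[m/n]*n (u * f y) p)
               (trans (+-comm _ ((u * f y) / p * p)) (cong (_+ (u * f y) % p) (*-comm _ p))))
        (∑-cong ys)

  module _ (_≟′_ : DecidableEquality A) where

    ∑-point-∉ : ∀ {xs v a} → All (v ≢_) xs → ∑ xs (λ y → if isYes (v ≟′ y) then a else 0) ≡ 0
    ∑-point-∉ []                 = refl
    ∑-point-∉ {x ∷ _} {v} (v≢x ∷ v∉xs) with v ≟′ x
    ... | yes v≡x = contradiction v≡x v≢x
    ... | no _    = ∑-point-∉ v∉xs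

    -- At most one entry of a list without repetitions equals `v`. There may be none: the zero
    -- vector, for example, is missing from `normals`.
    ∑-point : ∀ {xs} v a → Unique xs → ∑ xs (λ y → if isYes (v ≟′ y) then a else 0) ≤ a
    ∑-point v a [] = z≤n
    ∑-point {x ∷ xs} v a (x∉xs ∷ uniq) with v ≟′ x
    ... | yes refl = ≤-reflexive (trans (cong (a +_) (∑-point-∉ x∉xs)) (+-identityʳ a))
    ... | no _     = ∑-point v a uniq

∑-swap : ∀ {A B : Set} (xs : List A) (ys : List B) (f : A → B → ℕ) →
         ∑ xs (λ x → ∑ ys (f x)) ≡ ∑ ys (λ y → ∑ xs (λ x → f x y))
∑-swap [] ys f = zeros ys
  where
  zeros : ∀ ys → 0 ≡ ∑ ys (λ _ → 0)
  zeros []       = refl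
  zeros (_ ∷ ys) = zeros ys
∑-swap (x ∷ xs) ys f = trans (cong (∑ ys (f x) +_) (∑-swap xs ys f)) (sym (∑-+ ys (f x) _))

-- Inverses modulo p, and estimates for θ.

inverse-mod : ∀ {p} .{{_ : NonZero p}} → Prime p → 1 < p → ∀ a → 0 < a → a < p → ∃ λ u → (u * a) % p ≡ 1
inverse-mod {p} pr 1<p a 0<a a<p with coprime-Bézout (prime⇒coprime pr {{>-nonZero 0<a}} a<p)
... | Bézout.-+ x y eq = y , (begin
  (y * a) % p     ≡⟨ cong (_% p) eq ⟨
  (1 + x * p) % p ≡⟨ [m+kn]%n≡m%n 1 x p ⟩
  1 % p           ≡⟨ m<n⇒m%n≡m 1<p ⟩
  1               ∎)
  where open ≡-Reasoning
-- Here `1 + y * a` is a multiple of `p`, so `y` is an inverse up to sign; multiplying by `pred p`,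
-- which is -1 modulo `p`, corrects the sign.
... | Bézout.+- x y eq = pred p * y , (begin
  (pred p * y * a) % p                     ≡⟨ cong (_% p) (*-assoc (pred p) y a) ⟩
  (pred p * (y * a)) % p                   ≡⟨ [m+kn]%n≡m%n (pred p * (y * a)) 1 p ⟨
  (pred p * (y * a) + 1 * p) % p           ≡⟨ cong (λ t → (pred p * (y * a) + 1 * t) % p) (suc-pred p) ⟨
  (pred p * (y * a) + 1 * suc (pred p)) % p ≡⟨ cong (_% p) (regroup (pred p) (y * a)) ⟩
  (1 + pred p * (1 + y * a)) % p           ≡⟨ cong (λ t → (1 + pred p * t) % p) eq ⟩
  (1 + pred p * (x * p)) % p               ≡⟨ cong (λ t → (1 + t) % p) (*-assoc (pred p) x p) ⟨
  (1 + pred p * x * p) % p                 ≡⟨ [m+kn]%n≡m%n 1 (pred p * x) p ⟩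
  1 % p                                    ≡⟨ m<n⇒m%n≡m 1<p ⟩
  1                                        ∎)
  where
  open ≡-Reasoning
  regroup : ∀ s t → s * t + 1 * suc s ≡ 1 + s * (1 + t)
  regroup = solve-∀

θ≤q^ : ∀ q e → 2 ≤ q → θ e q ≤ q ^ suc e
θ≤q^ q zero    2≤q = ≤-trans (≤-trans (n≤1+n 1) 2≤q) (≤-reflexive (sym (*-identityʳ q)))
θ≤q^ q (suc e) 2≤q = begin
  q ^ suc e + θ e q         ≤⟨ +-monoʳ-≤ (q ^ suc e) (θ≤q^ q e 2≤q) ⟩
  q ^ suc e + q ^ suc e     ≡⟨ double (q ^ suc e) ⟩
  2 * q ^ suc e             ≤⟨ *-monoˡ-≤ (q ^ suc e) 2≤q ⟩
  q * q ^ suc e             ∎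
  where
  open ≤-Reasoning
  double : ∀ x → x + x ≡ 2 * x
  double = solve-∀

-- The leading power `q ^ suc e` alone is already at least `θ e q`. This makes the support large
-- enough when no further isolating subspace exists.
2*θ≤θ-suc : ∀ q e → 2 ≤ q → 2 * θ e q ≤ θ (suc e) q
2*θ≤θ-suc q e 2≤q = ≤-trans (≤-reflexive (cong (θ e q +_) (+-identityʳ _)))
  (+-monoˡ-≤ (θ e q) (θ≤q^ q e 2≤q))

θ-mono : ∀ q j e → θ e q ≤ θ (j + e) q
θ-mono q zero    e = ≤-refl
θ-mono q (suc j) e = ≤-trans (θ-mono q j e) (m≤n+m _ (q ^ suc (j + e)))

-- Together with p ≤ q this supplies the hypothesis `suc p ≤ r` of `bound>7`.
q<θ-suc : ∀ q e → suc q ≤ θ (suc e) q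
q<θ-suc q zero    = ≤-reflexive (trans (+-comm 1 q) (cong (_+ 1) (sym (*-identityʳ q))))
q<θ-suc q (suc e) = ≤-trans (q<θ-suc q e) (m≤n+m _ (q ^ suc (suc e)))

-- With p = 9 + s and r = 10 + s + t, p times the difference of the two sides
-- is at least (4 + 2s) r − 40 − 6s = slack s t; p = 8 is not prime.
bound>7 : ∀ {p r w} → Prime p → 7 < p → suc p ≤ r → 2 * (pred p * r + 1) ≤ p * w → 12 * r + 6 ≤ 7 * w
bound>7 {p} {r} {w} pr 7<p p<r bnd with m≤n⇒m<n∨m≡n 7<p
... | inj₂ refl = contradiction pr (from-no (prime? 8))
... | inj₁ 9≤p with m≤n⇒∃[o]m+o≡n 9≤p
... | s , refl with m≤n⇒∃[o]m+o≡n p<r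
... | t , refl = *-cancelˡ-≤ (9 + s) (begin
  (9 + s) * (12 * (10 + s + t) + 6)              ≤⟨ m≤m+n _ (slack s t) ⟩
  (9 + s) * (12 * (10 + s + t) + 6) + slack s t  ≡⟨ expand s t ⟩
  7 * (2 * ((8 + s) * (10 + s + t) + 1))         ≤⟨ *-monoʳ-≤ 7 bnd ⟩
  7 * ((9 + s) * w)                              ≡⟨ swap s w ⟩
  (9 + s) * (7 * w)                              ∎)
  where
  open ≤-Reasoning
  slack : ℕ → ℕ → ℕ
  slack s t = 18 * s + 4 * t + 2 * (s * s) + 2 * (s * t)
  expand : ∀ s t → (9 + s) * (12 * (10 + s + t) + 6) + (18 * s + 4 * t + 2 * (s * s) + 2 * (s * t))
                 ≡ 7 * (2 * ((8 + s) * (10 + s + t) + 1))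
  expand = solve-∀
  swap : ∀ s w → 7 * ((9 + s) * w) ≡ (9 + s) * (7 * w)
  swap = solve-∀

-- Linear algebra over the field: normal vectors and the quotient by a line.

module LinearAlgebra {q : ℕ} (F : FiniteField q) where
  open FiniteField F public

  commutativeRing : CommutativeRing _ _
  commutativeRing = record { isCommutativeRing = isCommutativeRing }

  open CommutativeRing commutativeRing
    using (distribˡ; distribʳ; zeroˡ; zeroʳ; -‿inverseˡ; -‿inverseʳ; ring)
    renaming ( +-assoc to ⊕-assoc; +-identityˡ to ⊕-identityˡ; +-identityʳ to ⊕-identityʳ
             ; *-assoc to ⊗-assoc; *-comm to ⊗-comm; *-identityˡ to ⊗-identityˡ; *-identityʳ to ⊗-identityʳ
             ; +-commutativeSemigroup to ⊕-commutativeSemigroup)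
  open Algebra.Properties.Ring ring using (-0#≈0#; -‿+-comm; -‿distribʳ-*)
  open Algebra.Properties.CommutativeSemigroup ⊕-commutativeSemigroup using (interchange)

  𝔽 : ℕ → Set
  𝔽 d = Vec (Fin q) d

  infixl 6 _⊕ᵥ_
  infixr 7 _·_

  _⊕ᵥ_ : ∀ {d} → 𝔽 d → 𝔽 d → 𝔽 d
  _⊕ᵥ_ = zipWith _⊕_

  _·_ : ∀ {d} → Fin q → 𝔽 d → 𝔽 d
  a · v = Vec.map (a ⊗_) v

  𝟎 : ∀ {d} → 𝔽 d
  𝟎 = replicate _ 0#

  _≟ᵥ_ : ∀ {d} (u v : 𝔽 d) → Dec (u ≡ v)
  _≟ᵥ_ = ≡-dec Fin._≟_

  ⊕ᵥ-identityˡ : ∀ {d} (v : 𝔽 d) → 𝟎 ⊕ᵥ v ≡ v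
  ⊕ᵥ-identityˡ = zipWith-identityˡ ⊕-identityˡ

  ⊕ᵥ-identityʳ : ∀ {d} (v : 𝔽 d) → v ⊕ᵥ 𝟎 ≡ v
  ⊕ᵥ-identityʳ = zipWith-identityʳ ⊕-identityʳ

  ⊕ᵥ-interchange : ∀ {d} (s t u v : 𝔽 d) → (s ⊕ᵥ t) ⊕ᵥ (u ⊕ᵥ v) ≡ (s ⊕ᵥ u) ⊕ᵥ (t ⊕ᵥ v)
  ⊕ᵥ-interchange []      []      []      []      = refl
  ⊕ᵥ-interchange (a ∷ s) (b ∷ t) (c ∷ u) (d ∷ v) = cong₂ _∷_ (interchange a b c d) (⊕ᵥ-interchange s t u v)

  ·-distribˡ : ∀ {d} a (u v : 𝔽 d) → a · (u ⊕ᵥ v) ≡ a · u ⊕ᵥ a · v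
  ·-distribˡ a []      []      = refl
  ·-distribˡ a (x ∷ u) (y ∷ v) = cong₂ _∷_ (distribˡ a x y) (·-distribˡ a u v)

  ·-distribʳ : ∀ {d} a b (v : 𝔽 d) → (a ⊕ b) · v ≡ a · v ⊕ᵥ b · v
  ·-distribʳ a b []      = refl
  ·-distribʳ a b (x ∷ v) = cong₂ _∷_ (distribʳ x a b) (·-distribʳ a b v)

  ·-assoc : ∀ {d} a b (v : 𝔽 d) → (a ⊗ b) · v ≡ a · b · v
  ·-assoc a b []      = refl
  ·-assoc a b (x ∷ v) = cong₂ _∷_ (⊗-assoc a b x) (·-assoc a b v)

  1·-identity : ∀ {d} (v : 𝔽 d) → 1# · v ≡ v
  1·-identity []      = refl
  1·-identity (x ∷ v) = cong₂ _∷_ (⊗-identityˡ x) (1·-identity v)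

  0·-zero : ∀ {d} (v : 𝔽 d) → 0# · v ≡ 𝟎
  0·-zero []      = refl
  0·-zero (x ∷ v) = cong₂ _∷_ (zeroˡ x) (0·-zero v)

  ·-zeroʳ : ∀ {d} a → a · 𝟎 {d} ≡ 𝟎
  ·-zeroʳ {zero}  a = refl
  ·-zeroʳ {suc d} a = cong₂ _∷_ (zeroʳ a) (·-zeroʳ a)

  inverse-cancel : ∀ {d} a (v : 𝔽 d) → a ≢ 0# → (a ⁻¹) · a · v ≡ v
  inverse-cancel a v a≢0 = begin
    (a ⁻¹) · a · v    ≡⟨ ·-assoc (a ⁻¹) a v ⟨
    ((a ⁻¹) ⊗ a) · v  ≡⟨ cong (_· v) (trans (⊗-comm (a ⁻¹) a) (⁻¹-inverse a a≢0)) ⟩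
    1# · v            ≡⟨ 1·-identity v ⟩
    v                 ∎
    where open ≡-Reasoning

  -- The condition tested by `normalized`, as an inductive view: the constructors locate the pivot,
  -- so that `project` and `section` can recurse down to it.
  data Normal : ∀ {d} → 𝔽 (suc d) → Set where
    here  : ∀ {d} (v : 𝔽 d) → Normal (1# ∷ v)
    there : ∀ {d} {v : 𝔽 (suc d)} → Normal v → Normal (0# ∷ v)

  normal≢𝟎 : ∀ {d} {y : 𝔽 (suc d)} → Normal y → y ≢ 𝟎
  normal≢𝟎 (here v)  eq = 0≢1 (sym (∷-injectiveˡ eq))
  normal≢𝟎 (there N) eq = normal≢𝟎 N (∷-injectiveʳ eq)

  normal-torsion : ∀ {d} {y : 𝔽 (suc d)} {a} → Normal y → a · y ≡ 𝟎 → a ≡ 0#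
  normal-torsion {a = a} (here v)  eq = trans (sym (⊗-identityʳ a)) (∷-injectiveˡ eq)
  normal-torsion         (there N) eq = normal-torsion N (∷-injectiveʳ eq)

  -- The zero vector is sent to itself, which is not normal; so the points that a quotient map kills
  -- belong to no class.
  normalize : ∀ {d} → 𝔽 d → 𝔽 d
  normalize []      = []
  normalize (x ∷ v) with x Fin.≟ 0#
  ... | yes _ = 0# ∷ normalize v
  ... | no  _ = 1# ∷ (x ⁻¹) · v

  normalize-𝟎 : ∀ {d} → normalize (𝟎 {d}) ≡ 𝟎
  normalize-𝟎 {zero}  = refl
  normalize-𝟎 {suc d} with 0# Fin.≟ 0#
  ... | yes _  = cong (0# ∷_) normalize-𝟎
  ... | no 0≢0 = contradiction refl 0≢0

  normalize-· : ∀ {d} {y : 𝔽 (suc d)} {a} → Normal y → a ≢ 0# → normalize (a · y) ≡ y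
  normalize-· {a = a} (here v) a≢0 with (a ⊗ 1#) Fin.≟ 0#
  ... | yes a1≡0 = contradiction (trans (sym (⊗-identityʳ a)) a1≡0) a≢0
  ... | no  _    = cong (1# ∷_) (trans (cong (λ b → (b ⁻¹) · a · v) (⊗-identityʳ a)) (inverse-cancel a v a≢0))
  normalize-· {a = a} (there N) a≢0 with (a ⊗ 0#) Fin.≟ 0#
  ... | yes _    = cong (0# ∷_) (normalize-· N a≢0)
  ... | no a0≢0  = contradiction (zeroʳ a) a0≢0

  -- The scalar is nonzero because `u` is, and `normalize` removes it. So a projective point has
  -- only one normal representative.
  normal-proportional : ∀ {d} {u v : 𝔽 (suc d)} {a} → Normal u → Normal v → u ≡ a · v → u ≡ v
  normal-proportional {u = u} {v} {a} Nu Nv u≡av = begin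
    u                   ≡⟨ normalize-· Nu (0≢1 ∘ sym) ⟨
    normalize (1# · u)  ≡⟨ cong normalize (1·-identity u) ⟩
    normalize u         ≡⟨ cong normalize u≡av ⟩
    normalize (a · v)   ≡⟨ normalize-· Nv a≢0 ⟩
    v                   ∎
    where
    open ≡-Reasoning
    a≢0 : a ≢ 0#
    a≢0 refl = normal≢𝟎 Nu (trans u≡av (0·-zero v))

  -- Quotient of 𝔽 (suc d) by the line ⟨y⟩: clear the pivot coordinate of y, then drop it.
  project : ∀ {d} {y : 𝔽 (suc d)} → Normal y → 𝔽 (suc d) → 𝔽 d
  project (here v)  (x ∷ u) = u ⊕ᵥ (⊖ x) · v
  project {suc d} (there N) (x ∷ u) = x ∷ project N u

  project-⊕ : ∀ {d} {y : 𝔽 (suc d)} (N : Normal y) u v → project N (u ⊕ᵥ v) ≡ project N u ⊕ᵥ project N v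
  project-⊕ (here w) (x ∷ u) (z ∷ v) = begin
    (u ⊕ᵥ v) ⊕ᵥ (⊖ (x ⊕ z)) · w              ≡⟨ cong (λ b → (u ⊕ᵥ v) ⊕ᵥ b · w) (-‿+-comm x z) ⟨
    (u ⊕ᵥ v) ⊕ᵥ ((⊖ x) ⊕ (⊖ z)) · w          ≡⟨ cong ((u ⊕ᵥ v) ⊕ᵥ_) (·-distribʳ (⊖ x) (⊖ z) w) ⟩
    (u ⊕ᵥ v) ⊕ᵥ ((⊖ x) · w ⊕ᵥ (⊖ z) · w)     ≡⟨ ⊕ᵥ-interchange u v _ _ ⟩
    (u ⊕ᵥ (⊖ x) · w) ⊕ᵥ (v ⊕ᵥ (⊖ z) · w)     ∎
    where open ≡-Reasoning
  project-⊕ (there N) (x ∷ u) (z ∷ v) = cong (x ⊕ z ∷_) (project-⊕ N u v)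

  project-· : ∀ {d} {y : 𝔽 (suc d)} (N : Normal y) a u → project N (a · u) ≡ a · project N u
  project-· (here w) a (x ∷ u) = begin
    a · u ⊕ᵥ (⊖ (a ⊗ x)) · w    ≡⟨ cong (λ b → a · u ⊕ᵥ b · w) (-‿distribʳ-* a x) ⟩
    a · u ⊕ᵥ (a ⊗ (⊖ x)) · w    ≡⟨ cong (a · u ⊕ᵥ_) (·-assoc a (⊖ x) w) ⟩
    a · u ⊕ᵥ a · (⊖ x) · w      ≡⟨ ·-distribˡ a u _ ⟨
    a · (u ⊕ᵥ (⊖ x) · w)        ∎
    where open ≡-Reasoning
  project-· (there N) a (x ∷ u) = cong (a ⊗ x ∷_) (project-· N a u)

  project-self : ∀ {d} {y : 𝔽 (suc d)} (N : Normal y) → project N y ≡ 𝟎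
  project-self (here v) = begin
    v ⊕ᵥ (⊖ 1#) · v           ≡⟨ cong (_⊕ᵥ (⊖ 1#) · v) (1·-identity v) ⟨
    1# · v ⊕ᵥ (⊖ 1#) · v      ≡⟨ ·-distribʳ 1# (⊖ 1#) v ⟨
    (1# ⊕ (⊖ 1#)) · v         ≡⟨ cong (_· v) (-‿inverseʳ 1#) ⟩
    0# · v                    ≡⟨ 0·-zero v ⟩
    𝟎                         ∎
    where open ≡-Reasoning
  project-self {suc d} (there N) = cong (0# ∷_) (project-self N)

  -- The scalar is the pivot coordinate of `u`: that multiple of `y` is exactly what the projection
  -- subtracts.
  project-kernel : ∀ {d} {y : 𝔽 (suc d)} (N : Normal y) u → project N u ≡ 𝟎 → ∃ λ a → u ≡ a · y
  project-kernel (here v) (x ∷ u) eq = x , cong₂ _∷_ (sym (⊗-identityʳ x)) (begin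
    u                                ≡⟨ ⊕ᵥ-identityʳ u ⟨
    u ⊕ᵥ 𝟎                           ≡⟨ cong (u ⊕ᵥ_) (0·-zero v) ⟨
    u ⊕ᵥ 0# · v                      ≡⟨ cong (λ b → u ⊕ᵥ b · v) (-‿inverseˡ x) ⟨
    u ⊕ᵥ ((⊖ x) ⊕ x) · v             ≡⟨ cong (u ⊕ᵥ_) (·-distribʳ (⊖ x) x v) ⟩
    u ⊕ᵥ ((⊖ x) · v ⊕ᵥ x · v)        ≡⟨ zipWith-assoc ⊕-assoc u _ _ ⟨
    (u ⊕ᵥ (⊖ x) · v) ⊕ᵥ x · v        ≡⟨ cong (_⊕ᵥ x · v) eq ⟩
    𝟎 ⊕ᵥ x · v                       ≡⟨ ⊕ᵥ-identityˡ (x · v) ⟩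
    x · v                            ∎)
    where open ≡-Reasoning
  project-kernel {suc d} (there N) (x ∷ u) eq with project-kernel N u (∷-injectiveʳ eq)
  ... | a , u≡ay = a , cong₂ _∷_ (trans (∷-injectiveˡ eq) (sym (zeroʳ a))) u≡ay

  section : ∀ {d} {y : 𝔽 (suc d)} → Normal y → 𝔽 d → 𝔽 (suc d)
  section (here v)  u       = 0# ∷ u
  section (there N) (x ∷ u) = x ∷ section N u

  -- `section` inserts 0 at the pivot, so there is nothing to clear and `project` only drops this
  -- entry again.
  project-section : ∀ {d} {y : 𝔽 (suc d)} (N : Normal y) u → project N (section N u) ≡ u
  project-section (here v) u = begin
    u ⊕ᵥ (⊖ 0#) · v  ≡⟨ cong (λ b → u ⊕ᵥ b · v) -0#≈0# ⟩
    u ⊕ᵥ 0# · v      ≡⟨ cong (u ⊕ᵥ_) (0·-zero v) ⟩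
    u ⊕ᵥ 𝟎           ≡⟨ ⊕ᵥ-identityʳ u ⟩
    u                ∎
    where open ≡-Reasoning
  project-section (there N) (x ∷ u) = cong (x ∷_) (project-section N u)

-- Enumeration of vectors and points.

module Quotients {q : ℕ} (F : FiniteField q) (n : ℕ) where
  open LinearAlgebra F
  open PG F n

  concatMap-map : ∀ {A B C : Set} (f : A → B → C) xs ys →
                  concatMap (λ x → List.map (f x) ys) xs ≡ cartesianProductWith f xs ys
  concatMap-map f []       ys = refl
  concatMap-map f (x ∷ xs) ys = cong (List.map (f x) ys List.++_) (concatMap-map f xs ys)

  length-cartesianProductWith : ∀ {A B C : Set} (f : A → B → C) xs ys →
                                length (cartesianProductWith f xs ys) ≡ length xs * length ys
  length-cartesianProductWith f []       ys = refl
  length-cartesianProductWith f (x ∷ xs) ys = trans (length-++ (List.map (f x) ys))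
    (cong₂ _+_ (length-map (f x) ys) (length-cartesianProductWith f xs ys))

  allVecs-suc : ∀ m → allVecs (suc m) ≡ cartesianProductWith _∷_ (allFin q) (allVecs m)
  allVecs-suc m = concatMap-map _∷_ (allFin q) (allVecs m)

  allVecs-unique : ∀ m → Unique (allVecs m)
  allVecs-unique zero    = [] ∷ []
  allVecs-unique (suc m) = subst Unique (sym (allVecs-suc m))
    (Unique.cartesianProductWith⁺ _∷_ ∷-injective (Unique.allFin⁺ q) (allVecs-unique m))

  ∈-allVecs : ∀ {m} (v : 𝔽 m) → v ∈ allVecs m
  ∈-allVecs []      = here refl
  ∈-allVecs (x ∷ v) = subst (x ∷ v ∈_) (sym (allVecs-suc _))
    (∈-cartesianProductWith⁺ _∷_ (∈-allFin x) (∈-allVecs v))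

  length-allVecs : ∀ m → length (allVecs m) ≡ q ^ m
  length-allVecs zero    = refl
  length-allVecs (suc m) = begin
    length (allVecs (suc m))                                     ≡⟨ cong length (allVecs-suc m) ⟩
    length (cartesianProductWith _∷_ (allFin q) (allVecs m))     ≡⟨ length-cartesianProductWith _∷_ (allFin q) (allVecs m) ⟩
    length (allFin q) * length (allVecs m)                       ≡⟨ cong₂ _*_ (length-tabulate {n = q} id) (length-allVecs m) ⟩
    q * q ^ m                                                    ∎
    where open ≡-Reasoning

  -- Sorted by the position of the pivot, so that the length obeys the recursion of `θ`. The entries
  -- serve as the points of a quotient space.
  normals : ∀ d → List (𝔽 (suc d))
  normals zero    = List.map (1# ∷_) (allVecs 0)
  normals (suc d) = List.map (1# ∷_) (allVecs (suc d)) List.++ List.map (0# ∷_) (normals d)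

  length-normals : ∀ d → length (normals d) ≡ θ d q
  length-normals zero    = refl
  length-normals (suc d) = trans (length-++ (List.map (1# ∷_) (allVecs (suc d))))
    (cong₂ _+_ (trans (length-map (1# ∷_) (allVecs (suc d))) (length-allVecs (suc d)))
               (trans (length-map (0# ∷_) (normals d)) (length-normals d)))

  ∈-normals⇒Normal : ∀ {d} {y : 𝔽 (suc d)} → y ∈ normals d → Normal y
  ∈-normals⇒Normal {zero} (here refl) = here []
  ∈-normals⇒Normal {suc d} y∈ with ∈-++⁻ (List.map (1# ∷_) (allVecs (suc d))) y∈
  ... | inj₁ y∈₁ with ∈-map⁻ (1# ∷_) y∈₁
  ...   | v , _ , refl = here v
  ∈-normals⇒Normal {suc d} y∈ | inj₂ y∈₀ with ∈-map⁻ (0# ∷_) y∈₀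
  ...   | v , v∈ , refl = there (∈-normals⇒Normal v∈)

  normals-unique : ∀ d → Unique (normals d)
  normals-unique zero    = [] ∷ []
  normals-unique (suc d) = Unique.++⁺
    (Unique.map⁺ ∷-injectiveʳ (allVecs-unique (suc d)))
    (Unique.map⁺ ∷-injectiveʳ (normals-unique d))
    disjoint
    where
    disjoint : ∀ {v} → ¬ (v ∈ List.map (1# ∷_) (allVecs (suc d)) × v ∈ List.map (0# ∷_) (normals d))
    disjoint (v∈₁ , v∈₀) with ∈-map⁻ (1# ∷_) v∈₁ | ∈-map⁻ (0# ∷_) v∈₀
    ... | _ , _ , eq₁ | _ , _ , eq₀ = 0≢1 (∷-injectiveˡ (trans (sym eq₀) eq₁))

  points-unique : Unique points
  points-unique = Unique.filter⁺ (T? ∘ normalized) (allVecs-unique (suc n))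

  normalized⇒Normal : ∀ {d} (v : 𝔽 (suc d)) → T (normalized v) → Normal v
  normalized⇒Normal (x ∷ v) norm with x Fin.≟ 0#
  normalized⇒Normal (x ∷ z ∷ v) norm | yes refl = there (normalized⇒Normal (z ∷ v) norm)
  normalized⇒Normal (x ∷ v)     norm | no _ with x Fin.≟ 1#
  ... | yes refl = here v

  ∈-points⇒Normal : ∀ {Q} → Q ∈ points → Normal Q
  ∈-points⇒Normal {Q} Q∈ = normalized⇒Normal Q (proj₂ (∈-filter⁻ (T? ∘ normalized) {xs = allVecs (suc n)} Q∈))

  inSpan⇒comb : ∀ {m} (B : Vec (𝔽 (suc n)) m) {v} → T (inSpan B v) → ∃ λ l → comb l B ≡ v
  inSpan⇒comb {m} B {v} v∈ with Any.satisfied (any⁻ (λ l → isYes (comb l B ≟ᵥ v)) (allVecs m) v∈)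
  ... | l , eq with comb l B ≟ᵥ v
  ...   | yes l∙B≡v = l , l∙B≡v

  comb⇒inSpan : ∀ {m} (B : Vec (𝔽 (suc n)) m) l {v} → comb l B ≡ v → T (inSpan B v)
  comb⇒inSpan B l {v} l∙B≡v = any⁺ _ (Any.map (λ { refl → isYes-true }) (∈-allVecs l))
    where
    isYes-true : T (isYes (comb l B ≟ᵥ v))
    isYes-true with comb l B ≟ᵥ v
    ... | yes _     = _
    ... | no l∙B≢v  = contradiction l∙B≡v l∙B≢v

  -- Quotients by subspaces, and the partition of the points into classes.

  -- The quotient by the span of `basis` is carried in coordinates, so that its points are again
  -- normal vectors. Instances grow from `trivialQuotient` by `extend`, each step moving one
  -- dimension from `d` to `m`.
  record Quotient (m d : ℕ) : Set where
    field
      basis  : Vec (𝔽 (suc n)) m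
      indep  : LinIndep basis
      φ      : 𝔽 (suc n) → 𝔽 d
      φ-⊕    : ∀ u v → φ (u ⊕ᵥ v) ≡ φ u ⊕ᵥ φ v
      φ-·    : ∀ a u → φ (a · u) ≡ a · φ u
      lift   : 𝔽 d → 𝔽 (suc n)
      φ-lift : ∀ y → φ (lift y) ≡ y
      φ-comb : ∀ l → φ (comb l basis) ≡ 𝟎

    -- The part in the span of `basis` dies. The coefficient `a` of the new vector thus decides
    -- whether the combination leaves the smaller subspace.
    φ-comb-lift : ∀ {y} a l → φ (comb (a ∷ l) (lift y ∷ basis)) ≡ a · y
    φ-comb-lift {y} a l = begin
      φ (a · lift y ⊕ᵥ comb l basis)    ≡⟨ φ-⊕ _ _ ⟩
      φ (a · lift y) ⊕ᵥ φ (comb l basis) ≡⟨ cong₂ _⊕ᵥ_ (trans (φ-· a _) (cong (a ·_) (φ-lift y))) (φ-comb l) ⟩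
      a · y ⊕ᵥ 𝟎                         ≡⟨ ⊕ᵥ-identityʳ _ ⟩
      a · y                              ∎
      where open ≡-Reasoning

    φ-𝟎 : φ 𝟎 ≡ 𝟎
    φ-𝟎 = trans (cong φ (sym (0·-zero 𝟎))) (trans (φ-· 0# 𝟎) (0·-zero _))

    comb-drop : ∀ {b} l → comb (0# ∷ l) (b ∷ basis) ≡ comb l basis
    comb-drop {b} l = trans (cong (_⊕ᵥ comb l basis) (0·-zero b)) (⊕ᵥ-identityˡ _)

  open Quotient

  trivialQuotient : Quotient 0 (suc n)
  trivialQuotient = record
    { basis = [] ; indep = λ { [] _ → refl } ; φ = id
    ; φ-⊕ = λ _ _ → refl ; φ-· = λ _ _ → refl ; lift = id ; φ-lift = λ _ → refl
    ; φ-comb = λ { [] → refl } }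

  -- Applying φ to a vanishing combination leaves `a · y ≡ 𝟎`, which forces `a` to vanish; the
  -- independence of the old basis does the rest.
  indep-lift : ∀ {m d} (R : Quotient m (suc d)) {y} → Normal y → LinIndep (lift R y ∷ basis R)
  indep-lift R {y} N (a ∷ l) eq with normal-torsion N (trans (sym (φ-comb-lift R a l)) (trans (cong (φ R) eq) (φ-𝟎 R)))
  ... | refl = cong (0# ∷_) (indep R l (trans (sym (comb-drop R l)) eq))

  extend : ∀ {m d} → Quotient m (suc d) → ∀ {y} → Normal y → Quotient (suc m) d
  extend R {y} N = record
    { basis  = lift R y ∷ basis R
    ; indep  = indep-lift R N
    ; φ      = project N ∘ φ R
    ; φ-⊕    = λ u v → trans (cong (project N) (φ-⊕ R u v)) (project-⊕ N _ _)
    ; φ-·    = λ a u → trans (cong (project N) (φ-· R a u)) (project-· N a _)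
    ; lift   = lift R ∘ section N
    ; φ-lift = λ z → trans (cong (project N) (φ-lift R (section N z))) (project-section N z)
    ; φ-comb = λ { (a ∷ l) → trans (cong (project N) (φ-comb-lift R a l))
                      (trans (project-· N a y) (trans (cong (a ·_) (project-self N)) (·-zeroʳ a))) }
    }

  -- For normal `y` the sum runs over the points sent to a nonzero multiple of `y`: geometrically,
  -- the points outside the centre of the subspace one dimension larger that `y` represents.
  class : ∀ {m d} → Quotient m d → 𝔽 d → (𝔽 (suc n) → ℕ) → ℕ
  class R y g = ∑ points (λ Q → if isYes (normalize (φ R Q) ≟ᵥ y) then g Q else 0)

  -- Double counting: every point lies in at most one class, and `P` in none since its image is
  -- zero. So the `θ d q` classes and `P` contribute to the total separately.
  ∑-classes : ∀ {m d} (R : Quotient m (suc d)) {g t P} → P ∈ points → φ R P ≡ 𝟎 →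
              (∀ {y} → y ∈ normals d → t ≤ class R y g) → g P + t * θ d q ≤ ∑ points g
  ∑-classes {d = d} R {g} {t} {P} P∈ φP≡𝟎 t≤ = begin
    g P + t * θ d q                           ≡⟨ cong (λ r → g P + t * r) (length-normals d) ⟨
    g P + t * length (normals d)              ≤⟨ +-monoʳ-≤ (g P) (∑-const-≤ t≤) ⟩
    g P + ∑ (normals d) (λ y → class R y g)   ≡⟨ cong (g P +_) (∑-swap (normals d) points (λ y Q → weightIn Q y)) ⟩
    g P + ∑ points (λ Q → ∑ (normals d) (weightIn Q))
                                              ≤⟨ ∑-mono-gap P∈ (λ {Q} _ → ∑-point _≟ᵥ_ (normalize (φ R Q)) (g Q) (normals-unique d)) gap ⟩
    ∑ points g                                ∎
    where
    open ≤-Reasoning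
    weightIn : 𝔽 (suc n) → 𝔽 (suc d) → ℕ
    weightIn Q y = if isYes (normalize (φ R Q) ≟ᵥ y) then g Q else 0
    P-unclassified : All (normalize (φ R P) ≢_) (normals d)
    P-unclassified = All.tabulate λ y∈ eq → normal≢𝟎 (∈-normals⇒Normal y∈)
      (trans (sym eq) (trans (cong normalize φP≡𝟎) normalize-𝟎))
    gap : g P + ∑ (normals d) (weightIn P) ≤ g P
    gap = ≤-reflexive (trans (cong (g P +_) (∑-point-∉ _≟ᵥ_ P-unclassified)) (+-identityʳ (g P)))

-- Subspaces that meet the support in a single point.

-- The indicator of a nonzero value, as a number: support sizes become sums, and `∑-classes` counts
-- support points as well as adding values.
sgn : ℕ → ℕ
sgn zero    = 0
sgn (suc _) = 1

module Isolation {q : ℕ} (F : FiniteField q) (n : ℕ) where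
  open LinearAlgebra F
  open PG F n
  open Quotients F n
  open Quotient

  supportSize : (𝔽 (suc n) → ℕ) → ℕ
  supportSize g = ∑ points (sgn ∘ g)

  -- An (m − 1)-dimensional projective subspace, given with the quotient by it,
  -- that meets the support of g in P only.
  record Isolating (g : 𝔽 (suc n) → ℕ) (P : 𝔽 (suc n)) (m d : ℕ) : Set where
    field
      quotient : Quotient m d
      coords   : ∃ λ l → comb l (basis quotient) ≡ P
      isolated : ∀ {Q} → Q ∈ points → g Q ≢ 0 → φ quotient Q ≡ 𝟎 → Q ≡ P

    φ-centre : φ quotient P ≡ 𝟎
    φ-centre = trans (cong (φ quotient) (sym (proj₂ coords))) (φ-comb quotient (proj₁ coords))

  open Isolating

  -- The kernel of the projection from `P` consists of the multiples of `P`, and proportional normal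
  -- vectors are equal.
  isolating-point : ∀ g {P} → P ∈ points → Isolating g P 1 n
  isolating-point g {P} P∈ = record
    { quotient = extend trivialQuotient N
    ; coords   = (1# ∷ []) , trans (⊕ᵥ-identityʳ (1# · P)) (1·-identity P)
    ; isolated = λ Q∈ _ πQ≡𝟎 →
        normal-proportional (∈-points⇒Normal Q∈) N (proj₂ (project-kernel N _ πQ≡𝟎))
    }
    where
    N : Normal P
    N = ∈-points⇒Normal P∈

  -- A support point in the larger subspace has image `a · y`. If `a` is zero it was in the old
  -- subspace already, hence is `P`; otherwise it would be counted in a class that contains no
  -- support point.
  isolating-extend : ∀ {g P m d} (I : Isolating g P m (suc d)) {y} → Normal y →
                     class (quotient I) y (sgn ∘ g) ≡ 0 → Isolating g P (suc m) d
  isolating-extend {g} {P} I {y} N empty = record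
    { quotient = extend R N
    ; coords   = (0# ∷ proj₁ (coords I)) , trans (comb-drop R (proj₁ (coords I))) (proj₂ (coords I))
    ; isolated = extend-isolated
    }
    where
    R = quotient I
    extend-isolated : ∀ {Q} → Q ∈ points → g Q ≢ 0 → project N (φ R Q) ≡ 𝟎 → Q ≡ P
    extend-isolated {Q} Q∈ gQ≢0 πφQ≡𝟎 with project-kernel N (φ R Q) πφQ≡𝟎
    ... | a , φQ≡ay with a Fin.≟ 0#
    ...   | yes refl = isolated I Q∈ gQ≢0 (trans φQ≡ay (0·-zero y))
    ...   | no a≢0   = contradiction (n≤0⇒n≡0 (≤-trans in-class (≤-reflexive empty))) sgn≢0
      where
      sgn≢0 : sgn (g Q) ≢ 0
      sgn≢0 with g Q
      ... | zero  = λ _ → gQ≢0 refl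
      ... | suc _ = λ ()
      in-class : sgn (g Q) ≤ class R y (sgn ∘ g)
      in-class with term≤∑ {f = λ Q → if isYes (normalize (φ R Q) ≟ᵥ y) then sgn (g Q) else 0} Q∈
      ... | bound with normalize (φ R Q) ≟ᵥ y
      ...   | yes _ = bound
      ...   | no ≢y = contradiction (trans (cong normalize φQ≡ay) (normalize-· N a≢0)) ≢y

  isolating-extend-or-all-hit :
    ∀ {g P m d} (I : Isolating g P m (suc d)) →
    (∀ {y} → y ∈ normals d → 1 ≤ class (quotient I) y (sgn ∘ g)) ⊎ Isolating g P (suc m) d
  isolating-extend-or-all-hit {g} {d = d} I
    with All.all? (λ y → 1 ≤? class (quotient I) y (sgn ∘ g)) (normals d)
  ... | yes all-hit = inj₁ (All.lookup all-hit)
  ... | no ¬all-hit with find (¬All⇒Any¬ (λ y → 1 ≤? class (quotient I) y (sgn ∘ g)) (normals d) ¬all-hit)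
  ...   | y , y∈ , ¬hit = inj₂ (isolating-extend I (∈-normals⇒Normal y∈) (n<1⇒n≡0 (≰⇒> ¬hit)))

  -- Here `j` counts the extensions still to be made. If one is impossible, every class contains a
  -- support point, and `P` is a further one. An earlier failure gives more classes, so `θ-mono`
  -- reduces all cases to failure at the last extension.
  isolating-or-large :
    ∀ {g P} → P ∈ points → g P ≡ 1 → ∀ j {m e} → Isolating g P m (suc j + e) →
    suc (θ (suc e) q) ≤ supportSize g ⊎ Isolating g P (j + m) (suc e)
  isolating-or-large P∈ gP≡1 zero I = inj₂ I
  isolating-or-large {g} {P} P∈ gP≡1 (suc j) {m} {e} I with isolating-extend-or-all-hit I
  ... | inj₂ I′ with isolating-or-large P∈ gP≡1 j I′
  ...   | inj₁ large = inj₁ large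
  ...   | inj₂ J     = inj₂ (subst (λ i → Isolating g P i (suc e)) (+-suc j m) J)
  isolating-or-large {g} {P} P∈ gP≡1 (suc j) {m} {e} I | inj₁ all-hit = inj₁ (begin
    suc (θ (suc e) q)                         ≤⟨ s≤s (θ-mono q j (suc e)) ⟩
    suc (θ (j + suc e) q)                     ≡⟨ cong (λ i → suc (θ i q)) (+-suc j e) ⟩
    suc (θ (suc j + e) q)                     ≡⟨ cong₂ _+_ (cong sgn gP≡1) (*-identityˡ _) ⟨
    sgn (g P) + 1 * θ (suc j + e) q           ≤⟨ ∑-classes (quotient I) P∈ (φ-centre I) all-hit ⟩
    supportSize g                             ∎)
    where open ≤-Reasoning

  -- The dual condition is applied to the span of the centre and a lift of `y`. The sum there is
  -- divisible by `p` and positive, because `P` contributes; outside the class of `y` only `P` can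
  -- contribute.
  p≤centre+class : ∀ {g P m d p} (I : Isolating g P m (suc d)) → 0 < g P → P ∈ points →
    (∀ (B : Vec (𝔽 (suc n)) (suc m)) → LinIndep B → p ∣ ∑ (subspacePoints B) g) →
    ∀ {y} → Normal y → p ≤ g P + class (quotient I) y g
  p≤centre+class {g} {P} {p = p} I 0<gP P∈ dual {y} N = begin
    p                                               ≤⟨ ∣⇒≤ {{>-nonZero (≤-trans 0<gP gP≤)}} (subst (p ∣_) (∑-filter (inSpan B) points g) (dual B (indep-lift R N))) ⟩
    ∑ points (λ Q → if inSpan B Q then g Q else 0)  ≤⟨ ∑-mono split ⟩
    ∑ points (λ Q → atP Q + inClass Q)              ≡⟨ ∑-+ points atP inClass ⟩
    ∑ points atP + class R y g                      ≤⟨ +-monoˡ-≤ _ (∑-point _≟ᵥ_ P (g P) points-unique) ⟩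
    g P + class R y g                               ∎
    where
    open ≤-Reasoning
    R = quotient I
    B = lift R y ∷ basis R
    atP inClass : 𝔽 (suc n) → ℕ
    atP Q = if isYes (P ≟ᵥ Q) then g P else 0
    inClass Q = if isYes (normalize (φ R Q) ≟ᵥ y) then g Q else 0
    P∈B : T (inSpan B P)
    P∈B = comb⇒inSpan B (0# ∷ proj₁ (coords I)) (trans (comb-drop R (proj₁ (coords I))) (proj₂ (coords I)))
    gP≤ : g P ≤ ∑ points (λ Q → if inSpan B Q then g Q else 0)
    gP≤ with term≤∑ {f = λ Q → if inSpan B Q then g Q else 0} P∈
    ... | bound with inSpan B P | P∈B
    ...   | true | _ = bound
    split : ∀ {Q} → Q ∈ points → (if inSpan B Q then g Q else 0) ≤ atP Q + inClass Q
    split {Q} Q∈ with inSpan B Q in Q∈B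
    ... | false = z≤n
    ... | true with inSpan⇒comb B {Q} (subst T (sym Q∈B) _)
    ...   | a ∷ l , refl with a Fin.≟ 0#
    ...     | no a≢0 with normalize (φ R Q) ≟ᵥ y
    ...       | yes _ = m≤n+m (g Q) (atP Q)
    ...       | no ≢y = contradiction (trans (cong normalize (φ-comb-lift R a l)) (normalize-· N a≢0)) ≢y
    -- With coefficient zero, `Q` lies in the isolating subspace: its value is zero or it is `P`.
    split {Q} Q∈ | true | a ∷ l , refl | yes refl with g Q ≟ 0
    ...       | yes gQ≡0 = ≤-trans (≤-reflexive gQ≡0) z≤n
    ...       | no gQ≢0 with isolated I Q∈ gQ≢0 (trans (φ-comb-lift R a l) (0·-zero y)) | P ≟ᵥ Q
    ...         | Q≡P | no P≢Q  = contradiction (sym Q≡P) P≢Q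
    ...         | Q≡P | yes P≡Q = ≤-trans (≤-reflexive (cong g Q≡P)) (m≤m+n (g P) _)

  -- Values are natural representatives below `p`, because their actual sums are estimated, not just
  -- their residues. The index `m` is a projective dimension, hence `suc m` basis vectors.
  record DualWord (p m : ℕ) : Set where
    field
      value  : 𝔽 (suc n) → ℕ
      value< : ∀ Q → value Q < p
      dual   : ∀ (B : Vec (𝔽 (suc n)) (suc m)) → LinIndep B → p ∣ ∑ (subspacePoints B) value

  open DualWord

  scale : ∀ {p m} .{{_ : NonZero p}} → ℕ → DualWord p m → DualWord p m
  scale {p} u c = record
    { value  = λ Q → (u * value c Q) % p
    ; value< = λ Q → m%n<n (u * value c Q) p
    ; dual   = λ B indep → ∣∑-scale p u (subspacePoints B) (value c) (dual c B indep)
    }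

  -- Zeros stay zero under scaling, so the support can only shrink.
  supportSize-scale : ∀ {p m} .{{_ : NonZero p}} u (c : DualWord p m) →
                      supportSize (value (scale u c)) ≤ supportSize (value c)
  supportSize-scale {p} u c = ∑-mono {xs = points} λ {Q} _ → sgn-scale (value c Q)
    where
    sgn≤1 : ∀ x → sgn x ≤ 1
    sgn≤1 zero    = z≤n
    sgn≤1 (suc _) = ≤-refl
    sgn-scale : ∀ x → sgn ((u * x) % p) ≤ sgn x
    sgn-scale zero    = ≤-reflexive (cong sgn (trans (cong (_% p) (*-zeroʳ u)) (m<n⇒m%n≡m (>-nonZero⁻¹ p))))
    sgn-scale (suc x) = sgn≤1 _

-- The lower bound for words that take the value 1.

-- The dual code of points and (k+1)-spaces in PG(k + 1 + e, q).
module WeightBound {q : ℕ} (F : FiniteField q) (2≤q : 2 ≤ q) (k e : ℕ) where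
  n : ℕ
  n = suc k + e
  open LinearAlgebra F
  open PG F n
  open Quotients F n
  open Isolation F n
  open Isolating
  open Quotient
  open DualWord

  -- From the point `P`, `k` extensions lead to projective dimension `k`, one below the subspaces of
  -- the code.
  large-or-isolating : ∀ {g P} → P ∈ points → g P ≡ 1 →
    suc (2 * θ e q) ≤ supportSize g ⊎ Isolating g P (suc k) (suc e)
  large-or-isolating {g} {P} P∈ gP≡1 with isolating-or-large P∈ gP≡1 k (isolating-point g P∈)
  ... | inj₁ large = inj₁ (≤-trans (s≤s (2*θ≤θ-suc q e 2≤q)) large)
  ... | inj₂ I     = inj₂ (subst (λ i → Isolating g P i (suc e)) (+-comm k 1) I)

  -- The modulus p is written `2 + s`: then `suc s` represents -1, and `s` is the largest of the
  -- other representatives.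
  module _ {s : ℕ} where

    -- Of the total of at least p, the centre accounts for 1.
    class-≥ : ∀ (c : DualWord (2 + s) (suc k)) {P} → P ∈ points → value c P ≡ 1 →
              (I : Isolating (value c) P (suc k) (suc e)) →
              ∀ {y} → y ∈ normals e → suc s ≤ class (quotient I) y (value c)
    class-≥ c {P} P∈ cP≡1 I {y} y∈ = ≤-pred (begin
      2 + s                                         ≤⟨ p≤centre+class I (≤-reflexive (sym cP≡1)) P∈ (dual c) (∈-normals⇒Normal y∈) ⟩
      value c P + class (quotient I) y (value c)    ≡⟨ cong (_+ class (quotient I) y (value c)) cP≡1 ⟩
      1 + class (quotient I) y (value c)            ∎)
      where open ≤-Reasoning

    total-≥ : ∀ (c : DualWord (2 + s) (suc k)) {P} → P ∈ points → value c P ≡ 1 →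
              suc (2 * θ e q) ≤ supportSize (value c) ⊎ 1 + suc s * θ e q ≤ ∑ points (value c)
    total-≥ c {P} P∈ cP≡1 with large-or-isolating P∈ cP≡1
    ... | inj₁ large = inj₁ large
    ... | inj₂ I     = inj₂ (subst (λ x → x + suc s * θ e q ≤ ∑ points (value c)) cP≡1
      (∑-classes (quotient I) P∈ (φ-centre I) (class-≥ c P∈ cP≡1 I)))

    -- Without the value −1, the classes each need two support points to reach p − 1.
    large-without-−1 : ∀ (c : DualWord (2 + s) (suc k)) {P} → P ∈ points → value c P ≡ 1 →
              (∀ {Q} → Q ∈ points → value c Q ≢ suc s) → suc (2 * θ e q) ≤ supportSize (value c)
    large-without-−1 c {P} P∈ cP≡1 ≢−1 with large-or-isolating P∈ cP≡1
    ... | inj₁ large = large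
    ... | inj₂ I     = subst (λ x → sgn x + 2 * θ e q ≤ supportSize (value c)) cP≡1
      (∑-classes (quotient I) P∈ (φ-centre I) two)
      where
      value≤ : ∀ {x} → x < 2 + s → x ≢ suc s → x ≤ s * sgn x
      value≤ {zero}  _   _   = z≤n
      value≤ {suc x} x<p x≢ = ≤-trans (≤-pred (≤∧≢⇒< (≤-pred x<p) x≢)) (≤-reflexive (sym (*-identityʳ s)))
      two : ∀ {y} → y ∈ normals e → 2 ≤ class (quotient I) y (sgn ∘ value c)
      -- A class total above `s`, made of values at most `s`, needs more than one nonzero term. For
      -- `s = 0` the strict inequality to be cancelled is absurd, so this case is covered too.
      two {y} y∈ = *-cancelˡ-< s 1 _ (begin-strict
        s * 1                                                   ≡⟨ *-identityʳ s ⟩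
        s                                                       <⟨ class-≥ c P∈ cP≡1 I y∈ ⟩
        class (quotient I) y (value c)                          ≤⟨ ∑-mono pointwise ⟩
        ∑ points (λ Q → s * (if isYes (normalize (φ (quotient I) Q) ≟ᵥ y) then sgn (value c Q) else 0))
                                                                ≡⟨ ∑-* s points _ ⟩
        s * class (quotient I) y (sgn ∘ value c)                ∎)
        where
        open ≤-Reasoning
        pointwise : ∀ {Q} → Q ∈ points →
          (if isYes (normalize (φ (quotient I) Q) ≟ᵥ y) then value c Q else 0) ≤
          s * (if isYes (normalize (φ (quotient I) Q) ≟ᵥ y) then sgn (value c Q) else 0)
        pointwise {Q} Q∈ with normalize (φ (quotient I) Q) ≟ᵥ y
        ... | yes _ = value≤ (value< c Q) (≢−1 Q∈)
        ... | no _  = z≤n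

    -- The remainder of `suc s * x` represents -x. For nonzero `x` the sum is a multiple of p below
    -- 2p, hence at most p.
    value+negation≤ : ∀ x → x < 2 + s → x + (suc s * x) % (2 + s) ≤ (2 + s) * sgn x
    value+negation≤ zero x<p = ≤-reflexive (trans (cong (_% (2 + s)) (*-zeroʳ (suc s))) (sym (*-zeroʳ (2 + s))))
    value+negation≤ x@(suc _) x<p = bounded p∣sum
      where
      y = (suc s * x) % (2 + s)
      swap : ∀ a b c → a + (b + c) ≡ c + (a + b)
      swap = solve-∀
      total : (2 + s) * x ≡ (2 + s) * ((suc s * x) / (2 + s)) + (x + y)
      total = begin
        (2 + s) * x                                     ≡⟨ cong (x +_) (m≡m%n+[m/n]*n (suc s * x) (2 + s)) ⟩
        x + (y + (suc s * x) / (2 + s) * (2 + s))       ≡⟨ swap x y _ ⟩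
        (suc s * x) / (2 + s) * (2 + s) + (x + y)       ≡⟨ cong (_+ (x + y)) (*-comm ((suc s * x) / (2 + s)) (2 + s)) ⟩
        (2 + s) * ((suc s * x) / (2 + s)) + (x + y)     ∎
        where open ≡-Reasoning
      p∣sum : 2 + s ∣ x + y
      p∣sum = ∣m+n∣m⇒∣n (subst (2 + s ∣_) total (m∣m*n x)) (m∣m*n ((suc s * x) / (2 + s)))
      open ≤-Reasoning
      bounded : 2 + s ∣ x + y → x + y ≤ (2 + s) * 1
      bounded (divides t sum≡) = begin
        x + y          ≡⟨ sum≡ ⟩
        t * (2 + s)    ≡⟨ *-comm t (2 + s) ⟩
        (2 + s) * t    ≤⟨ *-monoʳ-≤ (2 + s) (≤-pred t<2) ⟩
        (2 + s) * 1    ∎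
        where
        t<2 : t < 2
        t<2 = *-cancelʳ-< (2 + s) t 2 (begin-strict
          t * (2 + s)          ≡⟨ sum≡ ⟨
          x + y                <⟨ +-mono-< x<p (m%n<n (suc s * x) (2 + s)) ⟩
          (2 + s) + (2 + s)    ≡⟨ cong ((2 + s) +_) (+-identityʳ (2 + s)) ⟨
          2 * (2 + s)          ∎)

    -- Brings every case that ends in a large support to the form of the final bound, with
    -- `2 * r + s` to spare.
    large⇒bound : ∀ r {w} → suc (2 * r) ≤ w → 2 * (suc s * r + 1) ≤ (2 + s) * w
    large⇒bound r {w} large = begin
      2 * (suc s * r + 1)                  ≤⟨ m≤m+n _ (2 * r + s) ⟩
      2 * (suc s * r + 1) + (2 * r + s)    ≡⟨ regroup r s ⟩
      (2 + s) * suc (2 * r)                ≤⟨ *-monoʳ-≤ (2 + s) large ⟩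
      (2 + s) * w                          ∎
      where
      open ≤-Reasoning
      regroup : ∀ r s → 2 * (suc s * r + 1) + (2 * r + s) ≡ (2 + s) * suc (2 * r)
      regroup = solve-∀

    −1*−1 : (suc s * suc s) % (2 + s) ≡ 1
    −1*−1 = trans (cong (_% (2 + s)) (expand s)) (trans ([m+kn]%n≡m%n 1 s (2 + s)) (m<n⇒m%n≡m {n = 2 + s} (s≤s (s≤s z≤n))))
      where
      expand : ∀ s → suc s * suc s ≡ 1 + s * (2 + s)
      expand = solve-∀

    supportSize-bound : ∀ (c : DualWord (2 + s) (suc k)) {P} → P ∈ points → value c P ≡ 1 →
                        2 * (suc s * θ e q + 1) ≤ (2 + s) * supportSize (value c)
    supportSize-bound c {P} P∈ cP≡1 with Any.any? (λ Q → value c Q ≟ suc s) points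
    ... | no ∄−1 = large⇒bound (θ e q) (large-without-−1 c P∈ cP≡1 (λ Q∈ cQ≡−1 → ∄−1 (lose Q∈ cQ≡−1)))
    ... | yes ∃−1 with find ∃−1
    ...   | Q , Q∈ , cQ≡−1
      -- Negation is scaling by `suc s` and turns the value -1 at `Q` into 1, so the same estimate
      -- holds for the negated word with centre `Q`.
      with total-≥ c P∈ cP≡1
         | total-≥ (scale (suc s) c) Q∈ (trans (cong (λ x → (suc s * x) % (2 + s)) cQ≡−1) −1*−1)
    ...     | inj₁ large | _          = large⇒bound (θ e q) large
    ...     | inj₂ _     | inj₁ large = large⇒bound (θ e q) (≤-trans large (supportSize-scale (suc s) c))
    ...     | inj₂ t₁    | inj₂ t₂    = begin
      2 * (suc s * θ e q + 1)                                   ≡⟨ double (suc s * θ e q) ⟩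
      (1 + suc s * θ e q) + (1 + suc s * θ e q)                 ≤⟨ +-mono-≤ t₁ t₂ ⟩
      ∑ points (value c) + ∑ points (value (scale (suc s) c))   ≡⟨ ∑-+ points (value c) _ ⟨
      ∑ points (λ X → value c X + value (scale (suc s) c) X)    ≤⟨ ∑-mono {xs = points} (λ {X} _ → value+negation≤ (value c X) (value< c X)) ⟩
      ∑ points (λ X → (2 + s) * sgn (value c X))                ≡⟨ ∑-* (2 + s) points _ ⟩
      (2 + s) * supportSize (value c)                           ∎
      where
      open ≤-Reasoning
      double : ∀ x → 2 * (x + 1) ≡ (1 + x) + (1 + x)
      double = solve-∀

-- From codewords over the prime field to the theorem.

module _ {A : Set} (f : A → ℕ) where

  length-support : ∀ xs → length (filterᵇ (λ x → not (isYes (f x ≟ 0))) xs) ≡ ∑ xs (sgn ∘ f)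
  length-support []       = refl
  length-support (x ∷ xs) with f x
  ... | zero  = length-support xs
  ... | suc _ = cong suc (length-support xs)

  ∃-support : ∀ xs → 0 < ∑ xs (sgn ∘ f) → ∃ λ x → x ∈ xs × 0 < f x
  ∃-support (x ∷ xs) 0<∑ with f x in eq
  ... | suc _ = x , here refl , subst (0 <_) (sym eq) z<s
  ... | zero with ∃-support xs 0<∑
  ...   | y , y∈ , 0<fy = y , there y∈ , 0<fy

-- The Bagchi-Inamdar bound, cleared of its denominator p. Here `e` is the codimension of the
-- subspaces of the code.
weight-bound : ∀ {p q k e} (F : FiniteField q) → Prime p → 2 ≤ q → let n = suc k + e in
               (c : Vec (Fin q) (suc n) → Fin p) → PG.InDual F n p (suc k) c → 0 < PG.weight F n c →
               2 * (pred p * θ e q + 1) ≤ p * PG.weight F n c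
weight-bound {p} {q} {k} {e} F pr 2≤q c dual 0<w
  with m≤n⇒∃[o]m+o≡n (nonTrivial⇒n>1 p {{prime⇒nonTrivial pr}})
... | s , refl = from-support (∃-support (toℕ ∘ c) points (subst (0 <_) (length-support (toℕ ∘ c) points) 0<w))
  where
  open WeightBound F 2≤q k e
  open PG F n
  open Isolation F n
  word : DualWord (2 + s) (suc k)
  word = record { value = toℕ ∘ c ; value< = λ Q → toℕ<n (c Q) ; dual = dual }
  from-support : (∃ λ P → P ∈ points × 0 < toℕ (c P)) → 2 * (suc s * θ e q + 1) ≤ (2 + s) * weight c
  -- Multiplying by the inverse of the value at `P` makes that value 1.
  from-support (P , P∈ , 0<cP) with inverse-mod pr (s≤s (s≤s z≤n)) (toℕ (c P)) 0<cP (toℕ<n (c P))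
  ... | u , ucP≡1 = begin
    2 * (suc s * θ e q + 1)                                  ≤⟨ supportSize-bound (scale u word) P∈ ucP≡1 ⟩
    (2 + s) * supportSize (DualWord.value (scale u word))    ≤⟨ *-monoʳ-≤ (2 + s) (supportSize-scale u word) ⟩
    (2 + s) * supportSize (toℕ ∘ c)                          ≡⟨ cong ((2 + s) *_) (length-support (toℕ ∘ c) points) ⟨
    (2 + s) * weight c                                       ∎
    where open ≤-Reasoning

-- The codimension is at least 1; in successor form it fits `q<θ-suc`.
codimension : ∀ {n k} → 2 ≤ n → suc k ≤ n ∸ 1 → ∃ λ o → n ≡ suc k + suc o
codimension {suc _} {k} _ k<n with m≤n⇒∃[o]m+o≡n k<n
... | o , refl = o , cong suc (sym (+-suc k o))

theorem4p12 : (p h q n k : ℕ) → Prime p → 1 ≤ h → q ≡ p ^ h →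
    2 ≤ n → 1 ≤ k → k ≤ n ∸ 1 →
    (F : FiniteField q) →
    (c : Vec (Fin q) (suc n) → Fin p) →
    PG.InDual F n p k c → 0 < PG.weight F n c →
    (p ≡ 7 → 12 * θ (n ∸ k) q + 2 ≤ 7 * PG.weight F n c) ×
    (7 < p → 12 * θ (n ∸ k) q + 6 ≤ 7 * PG.weight F n c)
theorem4p12 p (suc h) q n (suc k) pr _ q≡p^h 2≤n _ k≤n∸1 F c dual 0<w
  with codimension 2≤n k≤n∸1
... | o , refl = p≡7⇒ , p>7⇒
  where
  w = PG.weight F (suc k + suc o) c
  r = θ (suc o) q
  codim : θ (suc k + suc o ∸ suc k) q ≡ r
  codim = cong (λ m → θ m q) (m+n∸m≡n k (suc o))
  p≤q : p ≤ q
  p≤q = ≤-trans (m≤m*n p (p ^ h) {{m^n≢0 p h {{prime⇒nonZero pr}}}}) (≤-reflexive (sym q≡p^h))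
  bound : 2 * (pred p * r + 1) ≤ p * w
  bound = weight-bound F pr (≤-trans (nonTrivial⇒n>1 p {{prime⇒nonTrivial pr}}) p≤q) c dual 0<w
  expand : ∀ r → 12 * r + 2 ≡ 2 * (6 * r + 1)
  expand = solve-∀
  p≡7⇒ : p ≡ 7 → 12 * θ (suc k + suc o ∸ suc k) q + 2 ≤ 7 * w
  -- For p = 7 the general bound is the claim itself, as `pred p` is 6.
  p≡7⇒ p≡7 = ≤-trans (≤-reflexive (trans (cong (λ r → 12 * r + 2) codim) (expand r)))
    (subst (λ p → 2 * (pred p * r + 1) ≤ p * w) p≡7 bound)
  p>7⇒ : 7 < p → 12 * θ (suc k + suc o ∸ suc k) q + 6 ≤ 7 * w
  p>7⇒ 7<p = ≤-trans (≤-reflexive (cong (λ r → 12 * r + 6) codim))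
    (bound>7 pr 7<p (≤-trans (s≤s p≤q) (q<θ-suc q o)) bound)
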